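{- The competitive ratio of any deterministic online algorithm for the one-dimensional online unit clustering problem is at least $13/8$. That is, if $ON$ is a deterministic online algorithm for this problem and $c$ is a real number such that $C_{ON}(\sigma) \le c \cdot C_{OPT}(\sigma)$ for every input $\sigma$, then $c \ge 13/8$.
   Context: One-dimensional online unit clustering problem. An input $\sigma$ is a finite sequence of points $p_1, p_2, \dots, p_n$ of the real line $\mathbb{R}$, revealed one at a time. An algorithm maintains a finite collection of clusters, each of which is a closed interval of length at most $1$; initially there are no clusters. When a point $p_i$ arrives that already lies in an existing cluster, nothing has to be done. When $p_i$ lies outside all existing clusters, the algorithm must, before the next point is revealed, cover $p_i$ by one of the following: (1) creating a new cluster, which has initial length $0$ and is the degenerate interval $[p_i,p_i]$; or (2) extending an existing cluster, i.e. replacing an existing cluster $[a,b]$ by an interval $[a',b'] \supseteq [a,b]$ with $p_i \in [a',b']$ and $b'-a' \le 1$. Clusters, once created, are never removed or shifted (they can only grow, and never beyond length $1$). The cost of an algorithm is the total number of clusters it has created. Deterministic online algorithm: each decision is a function of the points revealed so far (and the algorithm's own past decisions) only, with no knowledge of future points or of the length $n$ of the input, and no randomness. Notation: for an algorithm $ALG$ and an input $\sigma$, $C_{ALG}(\sigma)$ denotes the number of clusters created by $ALG$ on $\sigma$. $OPT$ is an optimal offline algorithm, which knows the whole of $\sigma$ in advance; thus $C_{OPT}(\sigma)$ is the minimum number of closed intervals of length at most $1$ whose union contains all points of $\sigma$. Competitive ratio: an online algorithm $ON$ is $c$-competitive (equivalently, its competitive ratio is at most $c$) if $C_{ON}(\sigma)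 \le c \cdot C_{OPT}(\sigma)$ for every input $\sigma$ (no additive constant). The competitive ratio of $ON$ is the infimum of all such $c$. -}

module Defs where

open import Algebra.Bundles.Raw using (RawMonoid)
import Algebra.Definitions.RawMonoid as NatMultiple
open import Data.Fin.Base using (Fin)
open import Data.Integer.Base using (+_)
open import Data.List.Base
  using (List; []; _∷_; _∷ʳ_; length; lookup; _[_]∷=_)
open import Data.List.Relation.Binary.Pointwise.Base using (Pointwise)
open import Data.List.Relation.Unary.All using (All)
open import Data.List.Relation.Unary.Any using (Any)
open import Data.Nat.Base as ℕ using (ℕ)
import Data.Nat.Properties as ℕ
open import Data.Product.Base using (∃-syntax; _×_; _,_)
open import Data.Rational.Base as ℚ using (ℚ; 0ℚ; 1ℚ; ½)
import Data.Rational.Properties as ℚ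
open import Data.Rational.Solver using (module +-*-Solver)
open import Level using (0ℓ)
open import Relation.Binary.PropositionalEquality
  using (_≡_; refl; sym; cong; subst)

open +-*-Solver using (solve; _:+_; _:*_; _:-_; :-_; _:=_; con)

-- The real numbers, as Cauchy sequences of rationals.  Two sequences denote
-- the same real number when they are related by _≈_ below.

Cauchy : (ℕ → ℚ) → Set
Cauchy x = ∀ ε → 0ℚ ℚ.< ε →
  ∃[ N ] (∀ m n → N ℕ.≤ m → N ℕ.≤ n → ℚ.∣ x m ℚ.- x n ∣ ℚ.< ε)

record ℝ : Set where
  constructor mkℝ
  field
    seq    : ℕ → ℚ
    cauchy : Cauchy seq

open ℝ public

infix 4 _≤_ _≈_

_≤_ : ℝ → ℝ → Set
x ≤ y = ∀ ε → 0ℚ ℚ.< ε →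
  ∃[ N ] (∀ n → N ℕ.≤ n → seq x n ℚ.≤ seq y n ℚ.+ ε)

_≈_ : ℝ → ℝ → Set
x ≈ y = x ≤ y × y ≤ x

fromℚ : ℚ → ℝ
fromℚ q = mkℝ (λ _ → q) λ ε 0<ε →
  0 , λ _ _ _ _ → subst (λ t → ℚ.∣ t ∣ ℚ.< ε) (sym (ℚ.+-inverseʳ q)) 0<ε

fromℕ : ℕ → ℝ
fromℕ n = fromℚ (+ n ℚ./ 1)

infixl 6 _+_ _-_
infix  8 -_

_+_ : ℝ → ℝ → ℝ
x + y = mkℝ (λ n → seq x n ℚ.+ seq y n) +-cauchy
  where
  +-cauchy : Cauchy (λ n → seq x n ℚ.+ seq y n)
  +-cauchy ε 0<ε
    with M , hM ← cauchy x (½ ℚ.* ε) (ℚ.*-monoʳ-<-pos ½ 0<ε)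
       | N , hN ← cauchy y (½ ℚ.* ε) (ℚ.*-monoʳ-<-pos ½ 0<ε)
    = M ℕ.⊔ N , λ m n M⊔N≤m M⊔N≤n → begin-strict
        ℚ.∣ (seq x m ℚ.+ seq y m) ℚ.- (seq x n ℚ.+ seq y n) ∣
          ≡⟨ cong ℚ.∣_∣ (solve 4 (λ a b c d →
               (a :+ b) :- (c :+ d) := (a :- c) :+ (b :- d)) refl
               (seq x m) (seq y m) (seq x n) (seq y n)) ⟩
        ℚ.∣ (seq x m ℚ.- seq x n) ℚ.+ (seq y m ℚ.- seq y n) ∣
          ≤⟨ ℚ.∣p+q∣≤∣p∣+∣q∣ (seq x m ℚ.- seq x n) (seq y m ℚ.- seq y n) ⟩
        ℚ.∣ seq x m ℚ.- seq x n ∣ ℚ.+ ℚ.∣ seq y m ℚ.- seq y n ∣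
          <⟨ ℚ.+-mono-<
               (hM m n (ℕ.m⊔n≤o⇒m≤o M N M⊔N≤m) (ℕ.m⊔n≤o⇒m≤o M N M⊔N≤n))
               (hN m n (ℕ.m⊔n≤o⇒n≤o M N M⊔N≤m) (ℕ.m⊔n≤o⇒n≤o M N M⊔N≤n)) ⟩
        ½ ℚ.* ε ℚ.+ ½ ℚ.* ε
          ≡⟨ solve 1 (λ e → con ½ :* e :+ con ½ :* e := e) refl ε ⟩
        ε ∎
    where open ℚ.≤-Reasoning

-_ : ℝ → ℝ
- x = mkℝ (λ n → ℚ.- seq x n) λ ε 0<ε →
  let N , h = cauchy x ε 0<ε in
  N , λ m n N≤m N≤n → subst (ℚ._< ε) (sym (lemma m n)) (h m n N≤m N≤n)
  where
  open Relation.Binary.PropositionalEquality.≡-Reasoning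
  lemma : ∀ m n →
    ℚ.∣ ℚ.- seq x m ℚ.- (ℚ.- seq x n) ∣ ≡ ℚ.∣ seq x m ℚ.- seq x n ∣
  lemma m n = begin
    ℚ.∣ ℚ.- seq x m ℚ.- (ℚ.- seq x n) ∣
      ≡⟨ cong ℚ.∣_∣ (sym (ℚ.neg-distrib-+ (seq x m) (ℚ.- seq x n))) ⟩
    ℚ.∣ ℚ.- (seq x m ℚ.- seq x n) ∣
      ≡⟨ ℚ.∣-p∣≡∣p∣ (seq x m ℚ.- seq x n) ⟩
    ℚ.∣ seq x m ℚ.- seq x n ∣ ∎

_-_ : ℝ → ℝ → ℝ
x - y = x + (- y)

+-0-rawMonoid : RawMonoid 0ℓ 0ℓ
+-0-rawMonoid = record { _≈_ = _≈_ ; _∙_ = _+_ ; ε = fromℚ 0ℚ }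

-- n · x is the product of the real x by the natural number n, i.e. the
-- n-fold sum x + (x + … + 0).
open NatMultiple +-0-rawMonoid public using () renaming (_×_ to _·_)

record Cluster : Set where
  constructor mkCluster
  field
    lo hi  : ℝ
    lo≤hi  : lo ≤ hi
    length≤1 : hi - lo ≤ fromℚ 1ℚ

open Cluster public

infix 4 _∈_ _⊆_ _≈ᶜ_

_∈_ : ℝ → Cluster → Set
p ∈ I = lo I ≤ p × p ≤ hi I

_⊆_ : Cluster → Cluster → Set
I ⊆ J = ∀ x → x ∈ I → x ∈ J

_≈ᶜ_ : Cluster → Cluster → Set
I ≈ᶜ J = lo I ≈ lo J × hi I ≈ hi J

singleton : ℝ → Cluster
singleton p = mkCluster p p p≤p p-p≤1
  where
  p≤p : p ≤ p
  p≤p ε 0<ε = 0 , λ n _ →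
    subst (ℚ._≤ seq p n ℚ.+ ε) (ℚ.+-identityʳ (seq p n))
      (ℚ.+-monoʳ-≤ (seq p n) (ℚ.<⇒≤ 0<ε))

  p-p≤1 : p - p ≤ fromℚ 1ℚ
  p-p≤1 ε 0<ε = 0 , λ n _ →
    subst (ℚ._≤ 1ℚ ℚ.+ ε) (sym (ℚ.+-inverseʳ (seq p n)))
      (ℚ.+-mono-≤ (ℚ.nonNegative⁻¹ 1ℚ) (ℚ.<⇒≤ 0<ε))

Covers : List Cluster → List ℝ → Set
Covers Is σ = All (λ p → Any (p ∈_) Is) σ

-- Step p cs cs′ : on arrival of p, an algorithm whose current clusters are cs
-- may change them to cs′.  It may leave them alone only if p is already
-- covered; on a covered point it need not do anything, but is not prevented
-- from doing so.

data Step (p : ℝ) (cs : List Cluster) : List Cluster → Set where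
  stay   : Any (p ∈_) cs → Step p cs cs
  new    : Step p cs (singleton p ∷ cs)
  extend : (i : Fin (length cs)) (J : Cluster) →
           lookup cs i ⊆ J → p ∈ J → Step p cs (cs [ i ]∷= J)

-- A deterministic online algorithm is given by the clusters it has after each
-- finite sequence of points.  Whatever follows σ, the configuration reached
-- after σ is clusters σ, so a decision can depend only on the points revealed
-- so far (which also determine all past decisions).  Being a function of real
-- numbers, it has to respect _≈_.

record OnlineAlgorithm : Set where
  field
    clusters : List ℝ → List Cluster
    initial  : clusters [] ≡ []
    step     : ∀ σ p → Step p (clusters σ) (clusters (σ ∷ʳ p))
    respects : ∀ {σ τ} → Pointwise _≈_ σ τ →
               Pointwise _≈ᶜ_ (clusters σ) (clusters τ)

open OnlineAlgorithm public

-- Clusters are never removed, so those present are all those ever created.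
C : OnlineAlgorithm → List ℝ → ℕ
C ON σ = length (clusters ON σ)

-- C-OPT σ k : the least number of clusters covering all points of σ is k.
C-OPT : List ℝ → ℕ → Set
C-OPT σ k = (∃[ Is ] (Covers Is σ × length Is ≡ k))
          × (∀ Is → Covers Is σ → k ℕ.≤ length Is)

_IsCompetitive_ : OnlineAlgorithm → ℝ → Set
ON IsCompetitive c = ∀ σ k → C-OPT σ k → fromℕ (C ON σ) ≤ k · c

{-# OPTIONS --safe #-}

-- The adversary plays multiples of 1/3.  Since clusters only grow, every
-- cluster contains the hull of the points it has been used for, whatever else
-- the algorithm puts into it.  Up to these hulls the algorithm has finitely many
-- replies to a point: a new cluster, or extending a hull that still fits into
-- length 1.  So the adversary's strategy is a finite tree; at each of its leaves
-- the algorithm has m clusters and the optimum k, with 13 k ≤ 8 m.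
--
-- The strategy forces hulls of full length 1, whose outer neighbours must be
-- covered by new clusters; the optimum avoids the extra intervals by splitting
-- these hulls.  To reach 13/8 rather than 8/5 it builds full hulls far from the
-- earlier ones and then links the two groups through the gap between them.

module Submission where

open import Data.Bool.Base using (Bool; true; false; if_then_else_)
open import Data.Fin.Base as Fin using (Fin; zero; suc)
import Data.Fin.Properties as Fin
open import Data.Integer.Base as ℤ using (+_)
import Data.Integer.Properties as ℤ
open import Data.List.Base
  using (List; []; _∷_; _∷ʳ_; length; lookup; map; _[_]∷=_)
open import Data.List.Properties using (map-++; length-map)
open import Data.List.Membership.Propositional using ()
  renaming (_∈_ to _∈ₗ_)
open import Data.List.Membership.DecPropositional using ()
  renaming (_∈?_ to ∈ₗ?)
open import Data.List.Membership.Propositional.Properties using (∈-lookup; ∈-map⁺)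
open import Data.List.Relation.Binary.Pointwise.Base
  using (Pointwise; []; _∷_)
open import Data.List.Relation.Binary.Pointwise.Properties using (Pointwise-length)
open import Data.List.Relation.Unary.All as All using (All; []; _∷_)
import Data.List.Relation.Unary.All.Properties as All
open import Data.List.Relation.Unary.AllPairs using (AllPairs; _∷_; allPairs?)
open import Data.List.Relation.Unary.Any as Any using (Any; here; there)
import Data.List.Relation.Unary.Any.Properties as Any
open import Data.Nat.Base as ℕ using (ℕ; zero; suc; z≤n; s≤s)
import Data.Nat.Properties as ℕ
open import Data.Product.Base using (∃-syntax; _×_; _,_)
open import Data.Rational.Base as ℚ using (ℚ; 0ℚ; 1ℚ; _/_)
import Data.Rational.Properties as ℚ
open import Data.Rational.Solver using (module +-*-Solver)
import Data.Rational.Unnormalised.Base as ℚᵘ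
import Data.Rational.Unnormalised.Properties as ℚᵘ
open import Data.Sum.Base using (inj₁; inj₂)
open import Function.Base using (_∘_; id)
open import Relation.Binary.Definitions using (tri<; tri≈; tri>)
open import Relation.Binary.PropositionalEquality
  using (_≡_; refl; sym; trans; cong; subst)
open import Relation.Nullary using (Dec; yes; no; ¬_; contradiction)
open import Relation.Nullary.Decidable
  using (True; toWitness; from-yes; _×-dec_)
open import Defs

open +-*-Solver using (solve; _:+_; _:*_; _:-_; _:=_; con)

-- Rational and real numbers

fromℚ-mono : ∀ {p q} → p ℚ.≤ q → fromℚ p ≤ fromℚ q
fromℚ-mono {p} {q} p≤q ε 0<ε = 0 , λ _ _ →
  subst (ℚ._≤ q ℚ.+ ε) (ℚ.+-identityʳ p) (ℚ.+-mono-≤ p≤q (ℚ.<⇒≤ 0<ε))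

-- Any constant below 4/3 separates grid points of a cluster.
∈-cluster⇒≤ : ∀ I {p q} → fromℚ p ∈ I → fromℚ q ∈ I →
              q ℚ.≤ + 5 / 4 ℚ.+ p
∈-cluster⇒≤ I {p} {q} (lo≤p , _) (_ , q≤hi)
  -- The tolerance enters three times, and 1 + 3 · 1/12 = 5/4 is still below 4/3.
  with L , lo≤p ← lo≤p (+ 1 / 12) (from-yes (0ℚ ℚ.<? + 1 / 12))
     | H , q≤hi ← q≤hi (+ 1 / 12) (from-yes (0ℚ ℚ.<? + 1 / 12))
     | N , len≤1 ← length≤1 I (+ 1 / 12) (from-yes (0ℚ ℚ.<? + 1 / 12))
  = begin
      q                ≤⟨ q≤hi n H≤n ⟩
      h ℚ.+ δ          ≡⟨ solve 3 (λ h l d → h :+ d := (h :- l) :+ l :+ d) refl h l δ ⟩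
      (h ℚ.- l) ℚ.+ l ℚ.+ δ
        ≤⟨ ℚ.+-monoˡ-≤ δ (ℚ.+-mono-≤ (len≤1 n N≤n) (lo≤p n L≤n)) ⟩
      (1ℚ ℚ.+ δ) ℚ.+ (p ℚ.+ δ) ℚ.+ δ
        ≡⟨ solve 1 (λ p → (con 1ℚ :+ con δ) :+ (p :+ con δ) :+ con δ
                       := con (+ 5 / 4) :+ p) refl p ⟩
      + 5 / 4 ℚ.+ p ∎
  where
  open ℚ.≤-Reasoning
  δ = + 1 / 12
  n = L ℕ.⊔ H ℕ.⊔ N
  L≤n = ℕ.≤-trans (ℕ.m≤m⊔n L H) (ℕ.m≤m⊔n (L ℕ.⊔ H) N)
  H≤n = ℕ.≤-trans (ℕ.m≤n⊔m L H) (ℕ.m≤m⊔n (L ℕ.⊔ H) N)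
  N≤n = ℕ.m≤n⊔m (L ℕ.⊔ H) N
  l = seq (lo I) n
  h = seq (hi I) n

ι : ℕ → ℚ
ι n = + n / 1

-- `_/_` divides out a gcd, which is stuck on a variable n. Facts about `ι` are therefore checked on
-- unnormalised fractions with denominator 1 and carried back.
toℚᵘ-ι : ∀ n → ℚ.toℚᵘ (ι n) ℚᵘ.≃ ℚᵘ.mkℚᵘ (+ n) 0
toℚᵘ-ι n = ℚ.toℚᵘ-fromℚᵘ (ℚᵘ.mkℚᵘ (+ n) 0)

ι-* : ∀ m n → ι (m ℕ.* n) ≡ ι m ℚ.* ι n
ι-* m n = ℚ.toℚᵘ-injective (begin
  ℚ.toℚᵘ (ι (m ℕ.* n))                        ≈⟨ toℚᵘ-ι (m ℕ.* n) ⟩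
  ℚᵘ.mkℚᵘ (+ (m ℕ.* n)) 0
    ≈⟨ ℚᵘ.*≡* (cong (ℤ._* + 1) (ℤ.pos-* m n)) ⟩
  ℚᵘ.mkℚᵘ (+ m) 0 ℚᵘ.* ℚᵘ.mkℚᵘ (+ n) 0
    ≈⟨ ℚᵘ.*-cong (toℚᵘ-ι m) (toℚᵘ-ι n) ⟨
  ℚ.toℚᵘ (ι m) ℚᵘ.* ℚ.toℚᵘ (ι n)              ≈⟨ ℚ.toℚᵘ-homo-* (ι m) (ι n) ⟨
  ℚ.toℚᵘ (ι m ℚ.* ι n)                        ∎)
  where open ℚᵘ.≃-Reasoning

ι-suc : ∀ n → ι (suc n) ≡ 1ℚ ℚ.+ ι n
ι-suc n = ℚ.toℚᵘ-injective (begin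
  ℚ.toℚᵘ (ι (suc n))                          ≈⟨ toℚᵘ-ι (suc n) ⟩
  ℚᵘ.mkℚᵘ (+ suc n) 0
    ≈⟨ ℚᵘ.*≡* (cong (λ i → (+ 1 ℤ.+ i) ℤ.* + 1) (sym (ℤ.*-identityʳ (+ n)))) ⟩
  ℚᵘ.1ℚᵘ ℚᵘ.+ ℚᵘ.mkℚᵘ (+ n) 0                 ≈⟨ ℚᵘ.+-congʳ ℚᵘ.1ℚᵘ (toℚᵘ-ι n) ⟨
  ℚᵘ.1ℚᵘ ℚᵘ.+ ℚ.toℚᵘ (ι n)                    ≈⟨ ℚ.toℚᵘ-homo-+ 1ℚ (ι n) ⟨
  ℚ.toℚᵘ (1ℚ ℚ.+ ι n)                         ∎)
  where open ℚᵘ.≃-Reasoning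

ι-mono : ∀ {m n} → m ℕ.≤ n → ι m ℚ.≤ ι n
ι-mono {m} {n} m≤n = ℚ.toℚᵘ-cancel-≤ (begin
  ℚ.toℚᵘ (ι m)     ≃⟨ toℚᵘ-ι m ⟩
  ℚᵘ.mkℚᵘ (+ m) 0  ≤⟨ ℚᵘ.*≤* (ℤ.*-monoʳ-≤-nonNeg (+ 1) (ℤ.+≤+ m≤n)) ⟩
  ℚᵘ.mkℚᵘ (+ n) 0  ≃⟨ toℚᵘ-ι n ⟨
  ℚ.toℚᵘ (ι n)     ∎)
  where open ℚᵘ.≤-Reasoning

seq-· : ∀ k c n → seq (k · c) n ≡ ι k ℚ.* seq c n
seq-· zero    c n = sym (ℚ.*-zeroˡ (seq c n))
seq-· (suc k) c n = trans
  (cong (seq c n ℚ.+_) (seq-· k c n))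
  (trans (solve 2 (λ c k → c :+ k :* c := (con 1ℚ :+ k) :* c) refl (seq c n) (ι k))
         (cong (ℚ._* seq c n) (sym (ι-suc k))))

ratio-bound : ∀ k m c → 0 ℕ.< k → 13 ℕ.* k ℕ.≤ 8 ℕ.* m →
              fromℕ m ≤ k · c → fromℚ (+ 13 / 8) ≤ c
ratio-bound (suc k′) m c _ 13k≤8m m≤kc ε 0<ε with N , m≤kc ← m≤kc ε 0<ε =
  N , λ n N≤n → let x = seq c n in
    ℚ.*-cancelˡ-≤-pos (ι 8) (ℚ.*-cancelˡ-≤-pos K (begin
      K ℚ.* (ι 8 ℚ.* (+ 13 / 8))
        ≡⟨ ℚ.*-comm K (ι 13) ⟩
      ι 13 ℚ.* K
        ≡⟨ ι-* 13 (suc k′) ⟨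
      ι (13 ℕ.* suc k′)
        ≤⟨ ι-mono 13k≤8m ⟩
      ι (8 ℕ.* m)
        ≡⟨ ι-* 8 m ⟩
      ι 8 ℚ.* ι m
        ≤⟨ ℚ.*-monoˡ-≤-nonNeg (ι 8) (m≤kc n N≤n) ⟩
      ι 8 ℚ.* (seq (suc k′ · c) n ℚ.+ ε)
        ≡⟨ cong (λ y → ι 8 ℚ.* (y ℚ.+ ε)) (seq-· (suc k′) c n) ⟩
      ι 8 ℚ.* (K ℚ.* x ℚ.+ ε)
        ≡⟨ cong (λ e → ι 8 ℚ.* (K ℚ.* x ℚ.+ e)) (sym (ℚ.*-identityˡ ε)) ⟩
      ι 8 ℚ.* (K ℚ.* x ℚ.+ 1ℚ ℚ.* ε)
        -- As K is at least 1, ε ≤ K ε, so the factor K cancels and the given ε serves unchanged.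
        ≤⟨ ℚ.*-monoˡ-≤-nonNeg (ι 8) (ℚ.+-monoʳ-≤ (K ℚ.* x)
             (ℚ.*-monoʳ-≤-nonNeg ε {{ℚ.nonNegative (ℚ.<⇒≤ 0<ε)}}
               (ι-mono {1} {suc k′} (s≤s z≤n)))) ⟩
      ι 8 ℚ.* (K ℚ.* x ℚ.+ K ℚ.* ε)
        ≡⟨ solve 4 (λ a k x e → a :* (k :* x :+ k :* e) := k :* (a :* (x :+ e)))
             refl (ι 8) K x ε ⟩
      K ℚ.* (ι 8 ℚ.* (x ℚ.+ ε)) ∎))
  where
  open ℚ.≤-Reasoning
  K = ι (suc k′)
  instance
    K-pos : ℚ.Positive K
    K-pos = ℚ.positive (ℚ.<-≤-trans (from-yes (0ℚ ℚ.<? 1ℚ)) (ι-mono {1} {suc k′} (s≤s z≤n)))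

-- The grid

-- Recursion lets `thirds (3 + a)` unfold for variable a, which is the form the ring solver needs.
thirds : ℕ → ℚ
thirds zero    = 0ℚ
thirds (suc n) = + 1 / 3 ℚ.+ thirds n

pt : ℕ → ℝ
pt = fromℚ ∘ thirds

thirds-mono : ∀ {m n} → m ℕ.≤ n → thirds m ℚ.≤ thirds n
thirds-mono {n = zero}  z≤n = ℚ.≤-refl
thirds-mono {n = suc n} z≤n =
  ℚ.+-mono-≤ (from-yes (0ℚ ℚ.≤? + 1 / 3)) (thirds-mono {n = n} z≤n)
thirds-mono (s≤s m≤n) = ℚ.+-monoʳ-≤ (+ 1 / 3) (thirds-mono m≤n)

pt-mono : ∀ {m n} → m ℕ.≤ n → pt m ≤ pt n
pt-mono = fromℚ-mono ∘ thirds-mono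

∈-cluster⇒near : ∀ I {a b} → pt a ∈ I → pt b ∈ I → b ℕ.≤ 3 ℕ.+ a
∈-cluster⇒near I {a} {b} a∈I b∈I with b ℕ.≤? 3 ℕ.+ a
... | yes b≤3+a = b≤3+a
... | no  b≰3+a = contradiction refl
                    (ℚ.<⇒≢ (ℚ.<-≤-trans 5/4+a<4/3+a 4/3+a≤5/4+a))
  where
  open ℚ.≤-Reasoning
  5/4+a<4/3+a : + 5 / 4 ℚ.+ thirds a ℚ.< + 4 / 3 ℚ.+ thirds a
  5/4+a<4/3+a = ℚ.+-monoˡ-< (thirds a) (from-yes (+ 5 / 4 ℚ.<? + 4 / 3))

  4/3+a≤5/4+a : + 4 / 3 ℚ.+ thirds a ℚ.≤ + 5 / 4 ℚ.+ thirds a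
  4/3+a≤5/4+a = begin
    + 4 / 3 ℚ.+ thirds a
      ≡⟨ solve 1 (λ x → con (+ 4 / 3) :+ x
                     := con ⅓ :+ (con ⅓ :+ (con ⅓ :+ (con ⅓ :+ x)))) refl (thirds a) ⟩
    thirds (4 ℕ.+ a)      ≤⟨ thirds-mono (ℕ.≰⇒> b≰3+a) ⟩
    thirds b              ≤⟨ ∈-cluster⇒≤ I a∈I b∈I ⟩
    + 5 / 4 ℚ.+ thirds a  ∎
    where ⅓ = + 1 / 3

unitFrom : ℕ → Cluster
unitFrom a = mkCluster (pt a) (pt (3 ℕ.+ a)) (pt-mono (ℕ.m≤n+m a 3))
  (fromℚ-mono (ℚ.≤-reflexive (solve 1 (λ x →
    (con ⅓ :+ (con ⅓ :+ (con ⅓ :+ x))) :- x := con 1ℚ) refl (thirds a))))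
  where ⅓ = + 1 / 3

-- The game on the grid

Hull : Set
Hull = ℕ × ℕ

hullWith : ℕ → Hull → Hull
hullWith p (a , b) = a ℕ.⊓ p , b ℕ.⊔ p

fits : Hull → Bool
fits (a , b) = b ℕ.≤ᵇ 3 ℕ.+ a

joins : ℕ → List Hull → List (List Hull)
joins p []       = []
joins p (h ∷ hs) =
  (if fits (hullWith p h) then (hullWith p h ∷ hs) ∷_ else id)
    (map (h ∷_) (joins p hs))

replies : ℕ → List Hull → List (List Hull)
replies p hs = ((p , p) ∷ hs) ∷ joins p hs

-- Left ends of the unit intervals of the greedy cover.  Nothing is proved about
-- it: won? checks for each σ that occurs that the result is an optimal cover.
-- All points of the strategy below lie in [0, 45).
greedy : ℕ → ℕ → List ℕ → List ℕ
greedy zero    x σ = []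
greedy (suc n) x σ with ∈ₗ? ℕ._≟_ x σ
... | yes _ = x ∷ greedy n (4 ℕ.+ x) σ
... | no  _ = greedy n (suc x) σ

Far : ℕ → ℕ → Set
Far x y = 3 ℕ.+ x ℕ.< y

_∈unitFrom_ : ℕ → ℕ → Set
p ∈unitFrom x = (x ℕ.≤ p) × (p ℕ.≤ 3 ℕ.+ x)

Optimal : List ℕ → List ℕ → Set
Optimal xs σ = AllPairs Far xs × All (_∈ₗ σ) xs × All (λ p → Any (p ∈unitFrom_) xs) σ

Won : List ℕ → List Hull → Set
Won σ hs = let xs = greedy 45 0 σ in
  Optimal xs σ × 0 ℕ.< length xs × 13 ℕ.* length xs ℕ.≤ 8 ℕ.* length hs

won? : ∀ σ hs → Dec (Won σ hs)
won? σ hs = let xs = greedy 45 0 σ in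
  (allPairs? (λ x y → 3 ℕ.+ x ℕ.<? y) xs
    ×-dec All.all? (λ x → ∈ₗ? ℕ._≟_ x σ) xs
    ×-dec All.all? (λ p → Any.any? (λ x → (x ℕ.≤? p) ×-dec (p ℕ.≤? 3 ℕ.+ x)) xs) σ)
  ×-dec (0 ℕ.<? length xs)
  ×-dec (13 ℕ.* length xs ℕ.≤? 8 ℕ.* length hs)

-- For concrete arguments `replies` and `won?` evaluate, so type checking a tree verifies that no
-- reply is missing and that each leaf is won.
data Wins (σ : List ℕ) (hs : List Hull) : Set where
  stop : {True (won? σ hs)} → Wins σ hs
  ask  : ∀ p → All (Wins (σ ∷ʳ p)) (replies p hs) → Wins σ hs

infixr 5 _▸_ _⟨_⟩_

pattern _▸_ p w     = ask p (w ∷ [])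
pattern _⟨_⟩_ p w v = ask p (w ∷ v ∷ [])

-- p ▸ w asks for a point p that no hull can reach, p ⟨ w ⟩ v for one that
-- exactly one hull can reach: play continues with w if p gets a new cluster,
-- and with v if that hull is extended.
strategy : Wins [] []
strategy =
  32 ▸ 35 ⟨ stop ⟩ 26 ▸ 29 ⟨ 37 ▸ 40 ⟨ stop ⟩ 42 ▸ 23 ⟨ 36 ▸ stop ⟩
      17 ▸ 20 ⟨ 11 ▸ 8 ⟨ 36 ▸ stop ⟩
          -- The ending 27, 31 of three branches gains a cluster at the same optimum: only the hull
          -- at 29 can reach 27, and if it does, 31 is out of its reach and of that of the full hull
          -- (32 , 35).
          6 ▸ 14 ⟨ 3 ⟨ 36 ▸ 27 ⟨ stop ⟩ 31 ▸ stop ⟩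
              0 ▸ 7 ▸ 36 ▸ stop ⟩
          12 ▸ 36 ▸ 18 ⟨ stop ⟩ 22 ▸ 27 ⟨ stop ⟩ 31 ▸ stop ⟩
      14 ▸ 21 ▸ 36 ▸ 27 ⟨ stop ⟩ 31 ▸ stop ⟩
  -- With (26 , 29) and (32 , 35) full, each of these points costs a cluster: five against three.
  23 ▸ 30 ▸ 36 ▸ stop

-- Offline cost

allPairs-lookup : ∀ {A : Set} {R : A → A → Set} {xs} → AllPairs R xs →
                  ∀ {i j} → i Fin.< j → R (lookup xs i) (lookup xs j)
allPairs-lookup (px ∷ _)  {zero}   {suc j} _         = All.lookup px (∈-lookup j)
allPairs-lookup (_ ∷ pxs) {suc i} {suc j} (s≤s i<j) = allPairs-lookup pxs i<j

far⇒apart : ∀ I {x y} → Far x y → pt x ∈ I → ¬ (pt y ∈ I)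
far⇒apart I x≪y x∈I y∈I = ℕ.<⇒≱ x≪y (∈-cluster⇒near I x∈I y∈I)

-- Pigeonhole: no cluster holds two far points, so choosing for each point a cluster that covers it
-- is injective.
packing : ∀ {xs Is} → AllPairs Far xs → All (λ x → Any (pt x ∈_) Is) xs →
          length xs ℕ.≤ length Is
packing {xs} {Is} far covered = Fin.injective⇒≤ {f = index} injective
  where
  cover : ∀ i → Any (pt (lookup xs i) ∈_) Is
  cover i = All.lookup covered (∈-lookup i)

  index : Fin (length xs) → Fin (length Is)
  index i = Any.index (cover i)

  separate : ∀ {i j} → i Fin.< j → ¬ (index i ≡ index j)
  separate {i} {j} i<j eq =
    far⇒apart (lookup Is (index i)) (allPairs-lookup far i<j)
      (Any.lookup-index (cover i))
      (subst (λ k → pt (lookup xs j) ∈ lookup Is k) (sym eq)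
             (Any.lookup-index (cover j)))

  injective : ∀ {i j} → index i ≡ index j → i ≡ j
  injective {i} {j} eq with Fin.<-cmp i j
  ... | tri< i<j _ _ = contradiction eq (separate i<j)
  ... | tri≈ _ i≡j _ = i≡j
  ... | tri> _ _ j<i = contradiction (sym eq) (separate j<i)

-- The list `xs` serves twice: as left ends of a cover, and as points of σ that need separate
-- clusters in any cover.
optimal⇒C-OPT : ∀ {xs σ} → Optimal xs σ → C-OPT (map pt σ) (length xs)
optimal⇒C-OPT {xs} {σ} (far , xs⊆σ , covered) =
  (map unitFrom xs , All.map⁺ (All.map cover covered) , length-map unitFrom xs) ,
  λ Is covers → packing far (All.map (λ x∈σ → All.lookup covers (∈-map⁺ pt x∈σ)) xs⊆σ)
  where
  cover : ∀ {p} → Any (p ∈unitFrom_) xs → Any (pt p ∈_) (map unitFrom xs)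
  cover = Any.map⁺ ∘ Any.map (λ (x≤p , p≤3+x) → pt-mono x≤p , pt-mono p≤3+x)

-- The algorithm on the grid

Contains : Hull → Cluster → Set
Contains (a , b) I = (pt a ∈ I) × (pt b ∈ I)

contains-hullWith : ∀ p h I → Contains h I → pt p ∈ I → Contains (hullWith p h) I
contains-hullWith p (a , b) I (a∈I , b∈I) p∈I = a⊓p∈I , b⊔p∈I
  where
  a⊓p∈I : pt (a ℕ.⊓ p) ∈ I
  a⊓p∈I with ℕ.⊓-sel a p
  ... | inj₁ eq rewrite eq = a∈I
  ... | inj₂ eq rewrite eq = p∈I

  b⊔p∈I : pt (b ℕ.⊔ p) ∈ I
  b⊔p∈I with ℕ.⊔-sel b p
  ... | inj₁ eq rewrite eq = b∈I
  ... | inj₂ eq rewrite eq = p∈I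

Reply : List (List Hull) → List Cluster → Set
Reply rs cs = ∃[ hs ] (hs ∈ₗ rs × Pointwise Contains hs cs)

joinHead : ∀ p h hs {J cs} → Contains (hullWith p h) J → Pointwise Contains hs cs →
           Reply (joins p (h ∷ hs)) (J ∷ cs)
joinHead p (a , b) hs {J} (a∈J , b∈J) rest
  with fits (hullWith p (a , b))
     -- Abstracted together with `fits`, this proof has an empty type in the `false` case, which
     -- therefore disappears.
     | ℕ.≤⇒≤ᵇ (∈-cluster⇒near J {a ℕ.⊓ p} {b ℕ.⊔ p} a∈J b∈J)
... | true  | _ = _ , here refl , (a∈J , b∈J) ∷ rest

joinTail : ∀ p h hs {I cs} → Contains h I → Reply (joins p hs) cs →
           Reply (joins p (h ∷ hs)) (I ∷ cs)
joinTail p h hs h⊆I (_ , r∈ , rest) with fits (hullWith p h)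
... | true  = _ , there (∈-map⁺ (h ∷_) r∈) , h⊆I ∷ rest
... | false = _ , ∈-map⁺ (h ∷_) r∈ , h⊆I ∷ rest

-- A cluster may cover p although its hull does not, having grown further than its points required.
-- Its hull can be enlarged to p all the same, so staying counts as an extension.
join-stay : ∀ p {hs cs} → Any (pt p ∈_) cs → Pointwise Contains hs cs →
            Reply (joins p hs) cs
join-stay p {h ∷ hs} {I ∷ _} (here p∈I) (h⊆I ∷ rest) =
  joinHead p h hs (contains-hullWith p h I h⊆I p∈I) rest
join-stay p {h ∷ hs} (there p∈cs) (h⊆I ∷ rest) =
  joinTail p h hs h⊆I (join-stay p p∈cs rest)

join-extend : ∀ p {hs cs J} (i : Fin (length cs)) → lookup cs i ⊆ J → pt p ∈ J →
              Pointwise Contains hs cs → Reply (joins p hs) (cs [ i ]∷= J)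
join-extend p {(a , b) ∷ hs} {J = J} zero I⊆J p∈J ((a∈I , b∈I) ∷ rest) =
  joinHead p (a , b) hs
    (contains-hullWith p (a , b) J (I⊆J (pt a) a∈I , I⊆J (pt b) b∈I) p∈J) rest
join-extend p {h ∷ hs} (suc i) I⊆J p∈J (h⊆I ∷ rest) =
  joinTail p h hs h⊆I (join-extend p i I⊆J p∈J rest)

reply : ∀ p {hs cs cs′} → Step (pt p) cs cs′ → Pointwise Contains hs cs →
        Reply (replies p hs) cs′
reply p (stay p∈cs) hs⊆cs with hs , hs∈ , rest ← join-stay p p∈cs hs⊆cs =
  hs , there hs∈ , rest
reply p new hs⊆cs = _ , here refl , (p∈p , p∈p) ∷ hs⊆cs
  where p∈p = lo≤hi (singleton (pt p)) , lo≤hi (singleton (pt p))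
reply p (extend i J I⊆J p∈J) hs⊆cs
  with hs , hs∈ , rest ← join-extend p i I⊆J p∈J hs⊆cs = hs , there hs∈ , rest

Beats : OnlineAlgorithm → Set
Beats ON = ∃[ σ ] ∃[ k ]
  (C-OPT σ k × 0 ℕ.< k × 13 ℕ.* k ℕ.≤ 8 ℕ.* C ON σ)

module _ (ON : OnlineAlgorithm) where

  play    : ∀ {σ hs} → Wins σ hs →
            Pointwise Contains hs (clusters ON (map pt σ)) → Beats ON
  -- Walks to the branch of the reply actually made; the recursion stays structural through the
  -- nested `All`.
  playAll : ∀ {σ rs} → All (Wins σ) rs → Reply rs (clusters ON (map pt σ)) → Beats ON

  play {σ} {hs} (stop {won}) hs⊆cs
    with optimal , 0<k , 13k≤8m ← toWitness won =
    map pt σ , _ , optimal⇒C-OPT optimal , 0<k ,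
    subst (λ m → _ ℕ.≤ 8 ℕ.* m) (Pointwise-length hs⊆cs) 13k≤8m
  play {σ} (ask p ws) hs⊆cs = playAll ws
    (reply p (subst (Step (pt p) (clusters ON (map pt σ)) ∘ clusters ON)
                (sym (map-++ pt σ (p ∷ []))) (step ON (map pt σ) (pt p))) hs⊆cs)

  playAll (w ∷ _)  (_ , here refl , hs⊆cs)  = play w hs⊆cs
  playAll (_ ∷ ws) (_ , there hs∈ , hs⊆cs) = playAll ws (_ , hs∈ , hs⊆cs)

theorem2p1 : (ON : OnlineAlgorithm) (c : ℝ) → ON IsCompetitive c → fromℚ (+ 13 / 8) ≤ c
theorem2p1 ON c competitive
  with σ , k , opt , 0<k , 13k≤8m ←
       play ON strategy (subst (Pointwise Contains []) (sym (initial ON)) [])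
  = ratio-bound k (C ON σ) c 0<k 13k≤8m (competitive σ k opt)
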